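{- There is no $2$-geodetic digraph with minimum out-degree at least $2$ and order $9$ whose in-degree sequence is $(1,1,1,2,2,2,3,3,3)$.
   Context: A digraph is $2$-geodetic if for any two vertices $u,v$ there is at most one directed walk from $u$ to $v$ of length at most $2$. The in-degree sequence is the list of in-degrees in non-decreasing order. -}

module Defs where

open import Data.Nat using (ℕ; _+_; _*_; _≤_)
open import Data.Bool using (Bool; true; false)
open import Data.Fin using (Fin)
open import Data.List using (List; map; allFin)
open import Data.Nat.ListAction using (sum)
open import Relation.Nullary.Decidable using (⌊_⌋)
open import Data.Fin using (_≟_)

-- A (simple) digraph on vertex set Fin n: arc relation as a Boolean matrix
-- (at most one arc u → v; loops are not excluded a priori, but a loop
-- violates 2-geodecity, see below).
Digraph : ℕ → Set
Digraph n = Fin n → Fin n → Bool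

b2n : Bool → ℕ
b2n true  = 1
b2n false = 0

Σ : {n : ℕ} → (Fin n → ℕ) → ℕ
Σ {n} f = sum (map f (allFin n))

outDeg : {n : ℕ} → Digraph n → Fin n → ℕ
outDeg G u = Σ (λ v → b2n (G u v))

inDeg : {n : ℕ} → Digraph n → Fin n → ℕ
inDeg G v = Σ (λ u → b2n (G u v))

walks0 : {n : ℕ} → Digraph n → Fin n → Fin n → ℕ
walks0 G u v = b2n ⌊ u ≟ v ⌋

walks1 : {n : ℕ} → Digraph n → Fin n → Fin n → ℕ
walks1 G u v = b2n (G u v)

walks2 : {n : ℕ} → Digraph n → Fin n → Fin n → ℕ
walks2 G u v = Σ (λ w → b2n (G u w) * b2n (G w v))

walks≤2 : {n : ℕ} → Digraph n → Fin n → Fin n → ℕ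
walks≤2 G u v = walks0 G u v + walks1 G u v + walks2 G u v

TwoGeodetic : {n : ℕ} → Digraph n → Set
TwoGeodetic G = ∀ u v → walks≤2 G u v ≤ 1

MinOutDeg≥ : {n : ℕ} → Digraph n → ℕ → Set
MinOutDeg≥ G d = ∀ u → d ≤ outDeg G u

inDegList : {n : ℕ} → Digraph n → List ℕ
inDegList {n} G = map (inDeg G) (allFin n)

{-# OPTIONS --safe #-}
-- Every vertex of a 2-geodetic digraph G of order 9 and minimum out-degree at
-- least 2 has in-degree at least 2.  Select two out-neighbours of every vertex.
-- A vertex, its two selected out-neighbours and their four selected
-- out-neighbours are distinct, so G can be relabelled such that the selected
-- out-neighbourhoods of 0, 1, 2 are {1,2}, {3,4}, {5,6}.  A backtracking search
-- over the six remaining out-neighbourhoods, run by the type checker, finds that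
-- every completion without a repeated vertex in such a ball has all in-degrees
-- at least 2.
module Submission where

open import Defs
open import Data.Bool using (Bool; true; false; if_then_else_; _∨_; T)
open import Data.Bool.ListAction using (all)
open import Data.Bool.Properties using (T-≡)
open import Data.Fin using (Fin; zero; suc; #_; _<_; _≟_)
open import Data.Fin.Properties using (_<?_; <-cmp; <⇒≢; suc-injective; all?; any?)
open import Data.List using (List; _∷_; []; _++_; map; concatMap; allFin; filter; length; lookup)
open import Data.List.Properties using (map-tabulate; length-tabulate)
open import Data.List.Membership.DecPropositional (_≟_ {9}) using (_∈?_)
open import Data.List.Membership.Propositional using (_∈_; _∉_; find)
open import Data.List.Membership.Propositional.Properties using (∈-allFin; ∈-filter⁺; ∈-filter⁻; ∈-++⁺ˡ; ∈-++⁺ʳ; ∈-map⁻; ∈-concatMap⁻; ∈-lookup)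
open import Data.List.Membership.Propositional.Properties.WithK using (unique∧set⇒bag)
open import Data.List.Relation.Binary.BagAndSetEquality using (∼bag⇒↭)
open import Data.List.Relation.Binary.Disjoint.Propositional using (Disjoint)
open import Data.List.Relation.Binary.Permutation.Propositional using (_↭_; ↭-sym)
open import Data.List.Relation.Binary.Permutation.Propositional.Properties using (∈-resp-↭; ↭-length)
open import Data.List.Relation.Unary.All as All using (All; []; _∷_)
open import Data.List.Relation.Unary.All.Properties as All using (all⁺)
open import Data.List.Relation.Unary.AllPairs as AllPairs using (AllPairs; []; _∷_)
open import Data.List.Relation.Unary.AllPairs.Properties as AllPairs using ()
open import Data.List.Relation.Unary.Any using (here; index)
open import Data.List.Relation.Unary.Any.Properties using (lookup-index)
open import Data.List.Relation.Unary.Unique.DecPropositional (_≟_ {9}) using (unique?)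
open import Data.List.Relation.Unary.Unique.Propositional using (Unique)
open import Data.List.Relation.Unary.Unique.Propositional.Properties using (++⁺; concat⁺; filter⁺; allFin⁺)
open import Data.Nat using (ℕ; zero; suc; _+_; _*_; _≤_; s≤s; s≤s⁻¹)
open import Data.Nat.ListAction using (sum)
open import Data.Nat.Properties using (≤-refl; ≤-reflexive; ≤-trans; +-mono-≤; +-monoʳ-≤; +-comm; m≤m+n; m≤n+m; *-mono-≤)
open import Data.Product using (∃; ∃₂; _×_; _,_; proj₁; proj₂)
open import Function using (_∘_; _on_; mk⇔; Injective; module Equivalence)
open import Level using (0ℓ)
open import Relation.Binary using (Rel; tri<; tri≈; tri>)
open import Relation.Binary.PropositionalEquality using (_≡_; _≢_; refl; sym; trans; cong; subst)
open import Relation.Nullary using (¬_; Dec; yes; no; does; contradiction; ¬?; _×-dec_)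
open import Relation.Nullary.Decidable using (⌊_⌋; toWitness)

private
  variable
    A : Set
    n : ℕ

-- Sums and counting over `Fin n`.

Σ-suc : (f : Fin (suc n) → ℕ) → Σ f ≡ f zero + Σ (f ∘ suc)
Σ-suc f = cong (λ ys → f zero + sum ys)
  (trans (map-tabulate suc f) (sym (map-tabulate (λ i → i) (f ∘ suc))))

term≤Σ : (f : Fin n → ℕ) → ∀ i → f i ≤ Σ f
term≤Σ f zero    rewrite Σ-suc f = m≤m+n _ _
term≤Σ f (suc i) rewrite Σ-suc f = ≤-trans (term≤Σ (f ∘ suc) i) (m≤n+m _ _)

-- The two terms will be the two midpoints of a diamond, or two in-neighbours of one vertex.
terms≤Σ : (f : Fin n → ℕ) → ∀ {i j} → i ≢ j → f i + f j ≤ Σ f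
terms≤Σ f {zero}  {zero}  i≢j = contradiction refl i≢j
terms≤Σ f {zero}  {suc j} i≢j rewrite Σ-suc f = +-monoʳ-≤ (f zero) (term≤Σ (f ∘ suc) j)
terms≤Σ f {suc i} {zero}  i≢j rewrite Σ-suc f | +-comm (f (suc i)) (f zero) =
  +-monoʳ-≤ (f zero) (term≤Σ (f ∘ suc) i)
terms≤Σ f {suc i} {suc j} i≢j rewrite Σ-suc f =
  ≤-trans (terms≤Σ (f ∘ suc) (i≢j ∘ cong suc)) (m≤n+m _ _)

count≥1 : (p : Fin n → Bool) → 1 ≤ Σ (b2n ∘ p) → ∃ λ i → p i ≡ true
count≥1 {n = suc n} p le rewrite Σ-suc (b2n ∘ p) with p zero in eq
... | true  = zero , eq
... | false with count≥1 (p ∘ suc) le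
...   | i , pi = suc i , pi

count≥2 : (p : Fin n → Bool) → 2 ≤ Σ (b2n ∘ p) → ∃₂ λ i j → i ≢ j × p i ≡ true × p j ≡ true
count≥2 {n = suc n} p le rewrite Σ-suc (b2n ∘ p) with p zero in eq
... | true  with count≥1 (p ∘ suc) (s≤s⁻¹ le)
...   | j , pj = zero , suc j , (λ ()) , eq , pj
count≥2 {n = suc n} p le | false with count≥2 (p ∘ suc) le
...   | i , j , i≢j , pi , pj = suc i , suc j , i≢j ∘ suc-injective , pi , pj

-- 2-geodetic relations.

record Geodetic (R : Rel A 0ℓ) : Set where
  field
    -- Two distinct walks of length at most 2 with the same ends have lengths 0 and 1, 0 and 2, 1
    -- and 2, or 2 and 2; the fields exclude these cases in this order.
    no-loop     : ∀ {u v} → R u v → u ≢ v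
    no-2-cycle  : ∀ {u v w} → R u v → R v w → u ≢ w
    no-shortcut : ∀ {u v w} → R u v → R v w → ¬ R u w
    no-diamond  : ∀ {u v w x} → R u v → R u w → v ≢ w → R v x → ¬ R w x

Geodetic-on : {B : Set} {R : Rel B 0ℓ} {f : A → B} → Injective _≡_ _≡_ f → Geodetic R → Geodetic (R on f)
Geodetic-on {f = f} inj geo = record
  { no-loop     = λ r → no-loop r ∘ cong f
  ; no-2-cycle  = λ r s → no-2-cycle r s ∘ cong f
  ; no-shortcut = no-shortcut
  ; no-diamond  = λ r s v≢w → no-diamond r s (v≢w ∘ inj)
  } where open Geodetic geo

Arc : Digraph n → Rel (Fin n) 0ℓ
Arc G u v = G u v ≡ true

module _ (G : Digraph n) where

  walks0-refl : ∀ u → 1 ≤ walks0 G u u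
  walks0-refl u with u ≟ u
  ... | yes _  = ≤-refl
  ... | no u≢u = contradiction refl u≢u

  walks1-arc : ∀ {u v} → Arc G u v → 1 ≤ walks1 G u v
  walks1-arc uv = ≤-reflexive (sym (cong b2n uv))

  middle : ∀ {u v w} → Arc G u w → Arc G w v → 1 ≤ b2n (G u w) * b2n (G w v)
  middle uw wv = *-mono-≤ (walks1-arc uw) (walks1-arc wv)

  walks2-path : ∀ {u v w} → Arc G u w → Arc G w v → 1 ≤ walks2 G u v
  walks2-path {u} {v} {w} uw wv = ≤-trans (middle uw wv) (term≤Σ (λ x → b2n (G u x) * b2n (G x v)) w)

  -- A violation of any field makes `walks≤2` at least 2: the two walks are counted in different
  -- summands, or, for a diamond, as two terms of `walks2`.
  geodetic : TwoGeodetic G → Geodetic (Arc G)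
  geodetic geo = record
    { no-loop     = λ { {u} uu refl → too-many (geo u u) (≤-trans (+-mono-≤ (walks0-refl u) (walks1-arc uu)) (m≤m+n _ _)) }
    ; no-2-cycle  = λ { {u} uv vu refl → too-many (geo u u) (+-mono-≤ (≤-trans (walks0-refl u) (m≤m+n _ (walks1 G u u))) (walks2-path uv vu)) }
    ; no-shortcut = λ {u} {v} {w} uv vw uw → too-many (geo u w)
        (+-mono-≤ (≤-trans (walks1-arc uw) (m≤n+m _ (walks0 G u w))) (walks2-path uv vw))
    ; no-diamond  = λ {u} {v} {w} {x} uv uw v≢w vx wx → too-many (geo u x)
        (≤-trans (+-mono-≤ (middle uv vx) (middle uw wx))
        (≤-trans (terms≤Σ (λ y → b2n (G u y) * b2n (G y x)) v≢w) (m≤n+m _ (walks0 G u x + walks1 G u x))))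
    }
    where
    too-many : ∀ {k} → k ≤ 1 → ¬ (2 ≤ k)
    too-many k≤1 2≤k with s≤s () ← ≤-trans 2≤k k≤1

  inDeg≥2 : ∀ {u v w} → u ≢ w → Arc G u v → Arc G w v → 2 ≤ inDeg G v
  inDeg≥2 {v = v} u≢w uv wv = ≤-trans (+-mono-≤ (walks1-arc uv) (walks1-arc wv)) (terms≤Σ (λ x → b2n (G x v)) u≢w)

-- Duplicate-free enumerations of the vertices.

lookup-injective : {xs : List A} → Unique xs → Injective _≡_ _≡_ (lookup xs)
lookup-injective (x∉ ∷ u) {zero}  {zero}  eq = refl
lookup-injective (x∉ ∷ u) {zero}  {suc j} eq = contradiction eq (All.lookup x∉ (∈-lookup j))
lookup-injective (x∉ ∷ u) {suc i} {zero}  eq = contradiction (sym eq) (All.lookup x∉ (∈-lookup i))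
lookup-injective (x∉ ∷ u) {suc i} {suc j} eq = cong suc (lookup-injective u eq)

-- Applied to a ball of seven vertices followed by the vertices it misses, this leaves exactly two
-- of the latter.
enumeration-length : {xs : List (Fin n)} → Unique xs → (∀ v → v ∈ xs) → length xs ≡ n
enumeration-length {n = n} u cover = trans
  (↭-length (∼bag⇒↭ (unique∧set⇒bag u (allFin⁺ n) (mk⇔ (λ _ → ∈-allFin _) (λ _ → cover _)))))
  (length-tabulate (λ i → i))

V : Set
V = Fin 9

extend : {xs : List V} → Unique xs → ∃ λ ys → Unique (xs ++ ys) × (∀ v → v ∈ xs ++ ys)
extend {xs} u = ys , ++⁺ u (filter⁺ new? (allFin⁺ 9)) (λ (p , q) → proj₂ (∈-filter⁻ new? q) p) , cover
  where
  new? : ∀ v → Dec (v ∉ xs)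
  new? v = ¬? (v ∈? xs)
  ys : List V
  ys = filter new? (allFin 9)
  cover : ∀ v → v ∈ xs ++ ys
  cover v with v ∈? xs
  ... | yes v∈xs = ∈-++⁺ˡ v∈xs
  ... | no  v∉xs = ∈-++⁺ʳ xs (∈-filter⁺ new? (∈-allFin v) v∉xs)

-- Balls of radius 2 in a selection of arcs.

ball : (A → List A) → A → List A
ball N u = u ∷ N u ++ concatMap N (N u)

-- `N u` may omit out-neighbours of `u`, so partial assignments made during the search qualify as
-- well.
Selects : Rel A 0ℓ → (A → List A) → Set
Selects R N = ∀ u → Unique (N u) × All (R u) (N u)

module _ {R : Rel A 0ℓ} (geo : Geodetic R) {N : A → List A} (sel : Selects R N) where
  open Geodetic geo

  private
    arc : ∀ {u v} → v ∈ N u → R u v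
    arc {u} = All.lookup (proj₂ (sel u))

    disjoint : ∀ {u xs} → All (R u) xs → Unique xs → AllPairs (Disjoint on N) xs
    disjoint []       []         = []
    disjoint (r ∷ rs) (x∉ ∷ uxs) =
      All.zipWith (λ (s , x≢y) {_} (p , q) → no-diamond r s x≢y (arc p) (arc q)) (rs , x∉) ∷ disjoint rs uxs

  -- A ball lists one entry per selected walk of length at most 2. A repetition involving the centre
  -- is a loop or a 2-cycle, one between the two levels is a shortcut, and one between two
  -- out-neighbourhoods in the second level is a diamond.
  ball-unique : ∀ u → Unique (ball N u)
  ball-unique u with uxs , rs ← sel u =
    All.++⁺ (All.map no-loop rs)
            (All.concat⁺ (All.map⁺ (All.map (λ r → All.map (no-2-cycle r) (proj₂ (sel _))) rs)))
    ∷ ++⁺ uxs (concat⁺ (All.map⁺ (All.universal (proj₁ ∘ sel) _)) (AllPairs.map⁺ (disjoint rs uxs)))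
          λ (p , q) → let _ , v∈ , w∈ = find (∈-concatMap⁻ N q) in no-shortcut (arc v∈) (arc w∈) (arc p)

-- The backtracking search and its soundness.

_[_↦_] : (V → List V) → V → List V → V → List V
(N [ v ↦ xs ]) u = if does (u ≟ v) then xs else N u

update-selects : {R : Rel V 0ℓ} {N : V → List V} {v : V} {xs : List V} →
  Selects R N → Unique xs → All (R v) xs → Selects R (N [ v ↦ xs ])
update-selects {v = v} sel uxs rs u with u ≟ v
... | yes refl = uxs , rs
... | no _     = sel u

-- The ball of `u` reads `N` only at `u` and at the members of `N u`, so these are the balls that a
-- change at `v` can affect.
RepeatNear : (V → List V) → V → Set
RepeatNear N v = ∃ λ u → v ∈ u ∷ N u × ¬ Unique (ball N u)

repeatNear? : ∀ N v → Dec (RepeatNear N v)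
repeatNear? N v = any? λ u → v ∈? (u ∷ N u) ×-dec ¬? (unique? (ball N u))

InDegrees≥2 : (V → List V) → Set
InDegrees≥2 N = ∀ v → ∃ λ u → v ∈ N u × ∃ λ w → u < w × v ∈ N w

inDegrees≥2? : ∀ N → Dec (InDegrees≥2 N)
inDegrees≥2? N = all? λ v → any? λ u → v ∈? N u ×-dec any? λ w → u <? w ×-dec v ∈? N w

-- The backbone is Boolean rather than a nested Dec, whose unevaluated proof
-- components would exhaust the memory of the type checker.
mutual
  search : List V → (V → List V) → Bool
  search []       N = ⌊ inDegrees≥2? N ⌋
  search (v ∷ vs) N = all (search₁ v vs N) (allFin 9)

  search₁ : V → List V → (V → List V) → V → Bool
  -- Testing `a` alone can discard it before any `b` is tried.
  search₁ v vs N a = ⌊ repeatNear? (N [ v ↦ a ∷ [] ]) v ⌋ ∨ all (search₂ v vs N a) (allFin 9)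

  search₂ : V → List V → (V → List V) → V → V → Bool
  search₂ v vs N a b = ⌊ ¬? (a <? b) ⌋ ∨
    (⌊ repeatNear? (N [ v ↦ a ∷ b ∷ [] ]) v ⌋ ∨ search vs (N [ v ↦ a ∷ b ∷ [] ]))

TwoInNeighbours : Rel A 0ℓ → A → Set
TwoInNeighbours R v = ∃₂ λ u w → u ≢ w × R u v × R w v

T-∨-resolve : {P : Set} (P? : Dec P) {x : Bool} → ¬ P → T (⌊ P? ⌋ ∨ x) → T x
T-∨-resolve (yes p) ¬p _ = contradiction p ¬p
T-∨-resolve (no _)  _  t = t

module _ {R : Rel V 0ℓ} (geo : Geodetic R)
         (out : ∀ u → ∃₂ λ a b → a < b × R u a × R u b) where

  no-repeat : ∀ {N} → Selects R N → ∀ {v} → ¬ RepeatNear N v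
  no-repeat sel (u , _ , dup) = dup (ball-unique geo sel u)

  two-in-neighbours : ∀ {N} → Selects R N → InDegrees≥2 N → ∀ v → TwoInNeighbours R v
  two-in-neighbours sel deg v with u , p , w , u<w , q ← deg v =
    u , w , <⇒≢ u<w , All.lookup (proj₂ (sel u)) p , All.lookup (proj₂ (sel w)) q

  -- The proof follows the branch that assigns to each vertex its pair from `out`. There `N` always
  -- selects arcs of `R`, so by `no-repeat` no pruning test closes the branch, and its leaf yields
  -- the in-neighbours.
  search-sound : ∀ vs N → search vs N ≡ true → Selects R N → ∀ v → TwoInNeighbours R v
  search-sound []       N t sel = two-in-neighbours sel (toWitness {a? = inDegrees≥2? N} (Equivalence.from T-≡ t))
  search-sound (x ∷ vs) N t sel = search-sound vs N₂ (Equivalence.to T-≡ t₂) sel₂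
    where
    a b : V
    a = proj₁ (out x)
    b = proj₁ (proj₂ (out x))
    a<b : a < b
    a<b = proj₁ (proj₂ (proj₂ (out x)))
    ra : R x a
    ra = proj₁ (proj₂ (proj₂ (proj₂ (out x))))
    rb : R x b
    rb = proj₂ (proj₂ (proj₂ (proj₂ (out x))))
    N₁ N₂ : V → List V
    N₁ = N [ x ↦ a ∷ [] ]
    N₂ = N [ x ↦ a ∷ b ∷ [] ]
    sel₁ : Selects R N₁
    sel₁ = update-selects sel ([] ∷ []) (ra ∷ [])
    sel₂ : Selects R N₂
    sel₂ = update-selects sel ((<⇒≢ a<b ∷ []) ∷ [] ∷ []) (ra ∷ rb ∷ [])
    t₁ : T (all (search₂ x vs N a) (allFin 9))
    t₁ = T-∨-resolve (repeatNear? N₁ x) (no-repeat sel₁)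
           (All.lookup (all⁺ (search₁ x vs N) (allFin 9) (Equivalence.from T-≡ t)) (∈-allFin a))
    t₂ : T (search vs N₂)
    t₂ = T-∨-resolve (repeatNear? N₂ x) (no-repeat sel₂)
           (T-∨-resolve (¬? (a <? b)) (λ a≮b → a≮b a<b)
             (All.lookup (all⁺ (search₂ x vs N a) (allFin 9) t₁) (∈-allFin b)))

start : V → List V
start zero             = # 1 ∷ # 2 ∷ []
start (suc zero)       = # 3 ∷ # 4 ∷ []
start (suc (suc zero)) = # 5 ∷ # 6 ∷ []
-- The empty list stands for out-neighbours not chosen yet.
start _                = []

unfilled : List V
unfilled = # 3 ∷ # 4 ∷ # 5 ∷ # 6 ∷ # 7 ∷ # 8 ∷ []

search-succeeds : search unfilled start ≡ true
search-succeeds = refl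

-- Relabelling so that the search applies.

module _ {R : Rel V 0ℓ} (geo : Geodetic R)
         (out : ∀ u → ∃₂ λ a b → a ≢ b × R u a × R u b) where

  private
    f g : V → V
    f u = proj₁ (out u)
    g u = proj₁ (proj₂ (out u))

    f≢g : ∀ u → f u ≢ g u
    f≢g u = proj₁ (proj₂ (proj₂ (out u)))

    Rf : ∀ u → R u (f u)
    Rf u = proj₁ (proj₂ (proj₂ (proj₂ (out u))))

    Rg : ∀ u → R u (g u)
    Rg u = proj₂ (proj₂ (proj₂ (proj₂ (out u))))

    N : V → List V
    N u = f u ∷ g u ∷ []

    N-selects : Selects R N
    N-selects u = (f≢g u ∷ []) ∷ ([] ∷ []) , Rf u ∷ Rg u ∷ []

  private
    -- No `with' on the result of search-sound, since that would normalise the whole search again;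
    -- in-neighbours≥2 is abstract for the same reason.
    from-labelling : ∀ ys → Unique (ball N zero ++ ys) → (∀ v → v ∈ ball N zero ++ ys) →
      length (ball N zero ++ ys) ≡ 9 → ∀ v → TwoInNeighbours R v
    from-labelling (y₁ ∷ y₂ ∷ []) uvs cover refl v =
      transport (search-sound (Geodetic-on σ-inj geo) out′ unfilled start search-succeeds start-selects (σ⁻¹ v))
      where
      -- The order of the ball dictates `start`: labels 1, 2 name the selected out-neighbours of
      -- `zero`, labels 3, 4 those of the vertex labelled 1, and labels 5, 6 those of the vertex
      -- labelled 2. The two vertices outside the ball get 7 and 8.
      σ : V → V
      σ = lookup (ball N zero ++ y₁ ∷ y₂ ∷ [])

      σ-inj : Injective _≡_ _≡_ σ
      σ-inj = lookup-injective uvs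

      σ⁻¹ : V → V
      σ⁻¹ w = index (cover w)

      σσ⁻¹ : ∀ w → w ≡ σ (σ⁻¹ w)
      σσ⁻¹ w = lookup-index (cover w)

      out′ : ∀ u → ∃₂ λ a b → a < b × R (σ u) (σ a) × R (σ u) (σ b)
      -- The search tries increasing pairs, so the two labels are sorted; equal labels would
      -- identify `f (σ u)` with `g (σ u)`.
      out′ u with subst (R (σ u)) (σσ⁻¹ _) (Rf (σ u)) | subst (R (σ u)) (σσ⁻¹ _) (Rg (σ u))
                | <-cmp (σ⁻¹ (f (σ u))) (σ⁻¹ (g (σ u)))
      ... | ra | rb | tri< a<b _ _ = _ , _ , a<b , ra , rb
      ... | ra | rb | tri> _ _ b<a = _ , _ , b<a , rb , ra
      ... | ra | rb | tri≈ _ a≡b _ =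
        contradiction (trans (σσ⁻¹ _) (trans (cong σ a≡b) (sym (σσ⁻¹ _)))) (f≢g (σ u))

      start-selects : Selects (R on σ) start
      start-selects zero                = ((λ ()) ∷ []) ∷ [] ∷ [] , Rf _ ∷ Rg _ ∷ []
      start-selects (suc zero)          = ((λ ()) ∷ []) ∷ [] ∷ [] , Rf _ ∷ Rg _ ∷ []
      start-selects (suc (suc zero))    = ((λ ()) ∷ []) ∷ [] ∷ [] , Rf _ ∷ Rg _ ∷ []
      start-selects (suc (suc (suc _))) = [] , []

      transport : (∃₂ λ i j → i ≢ j × R (σ i) (σ (σ⁻¹ v)) × R (σ j) (σ (σ⁻¹ v))) → TwoInNeighbours R v
      transport (i , j , i≢j , ri , rj) =
        σ i , σ j , i≢j ∘ σ-inj , subst (R (σ i)) (sym (σσ⁻¹ v)) ri , subst (R (σ j)) (sym (σσ⁻¹ v)) rj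

  abstract
    in-neighbours≥2 : ∀ v → TwoInNeighbours R v
    in-neighbours≥2 = let ys , uvs , cover = extend (ball-unique geo N-selects zero) in
      from-labelling ys uvs cover (enumeration-length uvs cover)

theorem9 : (G : Digraph 9) → TwoGeodetic G → MinOutDeg≥ G 2 →
    ¬ (inDegList G ↭ (1 ∷ 1 ∷ 1 ∷ 2 ∷ 2 ∷ 2 ∷ 3 ∷ 3 ∷ 3 ∷ []))
theorem9 G geo out perm
  -- The leading 1 of the sequence is the in-degree of some vertex `v`, which nevertheless has two
  -- in-neighbours.
  with v , _ , 1≡deg ← ∈-map⁻ (inDeg G) (∈-resp-↭ (↭-sym perm) (here refl))
  with u , w , u≢w , uv , wv ← in-neighbours≥2 (geodetic G geo) (λ u → count≥2 (G u) (out u)) v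
  with s≤s () ← subst (2 ≤_) (sym 1≡deg) (inDeg≥2 G u≢w uv wv)
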